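{- For every integer $k\ge1$, $$G^{(k-1)(k-2)\cdots1k}_{31\text{ - }2}(x)=\begin{cases}x^kC^3(x),&\text{if }k\ge2,\\ C(x),&\text{if }k=1,\end{cases}$$ where $C^3(x)=(C(x))^3$. Hence, for all $n\ge k$, $$N^{(k-1)(k-2)\cdots1k}_{31\text{ - }2}(n)=\begin{cases}C_{n-k+2}-C_{n-k+1},&\text{if }k\ge2,\\ C_n,&\text{if }k=1.\end{cases}$$
   Context: A permutation $\pi=\pi_1\cdots\pi_n$ of $\{1,\dots,n\}$ contains the generalized pattern $31\text{ - }2$ if there are indices $i,j$ with $i+1<j\le n$ such that $\pi_i\pi_{i+1}\pi_j$ is order-isomorphic to $312$; otherwise it avoids it. A permutation $\pi$ begins with a pattern $p=p_1\cdots p_k$ if $n\ge k$ and $\pi_1\cdots\pi_k$ is order-isomorphic to $p$; by convention, the empty permutation is also regarded as beginning with the pattern $1$ (the case $k=1$). The pattern $(k-1)(k-2)\cdots1k$ consists of $k-1,k-2,\dots,1$ in decreasing order followed by $k$ (for $k=1$ it is $1$, for $k=2$ it is $12$). $N^p_q(n)$ is the number of permutations of $\{1,\dots,n\}$ that avoid $q$ and begin with $p$, and $G^p_q(x)=\sum_{n\ge0}N^p_q(n)x^n$. $C(x)=\sum_{n\ge0}C_nx^n=\frac{1-\sqrt{1-4x}}{2x}$, with $C_n=\frac1{n+1}\binom{2n}{n}$ the Catalan numbers. -}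

module Defs where

open import Data.Fin.Base using (Fin; zero; suc; toℕ; inject≤; punchIn)
open import Data.Fin.Patterns using (0F)
open import Data.Fin.Permutation
  using (Permutation′; _⟨$⟩ʳ_; _≈_; id; insert; remove; insert-remove)
open import Data.Fin.Properties using (all?; any?; punchIn-injective)
open import Data.List.Base using (List; [_]; map; filter; length; upTo; allFin; cartesianProductWith)
import Data.List.Membership.Setoid.Properties as Membership
open import Data.List.Membership.Propositional.Properties using (∈-allFin)
import Data.List.Relation.Unary.Unique.Setoid as Unique
import Data.List.Relation.Unary.Unique.Setoid.Properties as Unique
open import Data.List.Relation.Unary.Unique.Propositional.Properties using (allFin⁺)
open import Data.List.Relation.Unary.Enumerates.Setoid using (IsEnumeration)
open import Data.List.Relation.Unary.Any using (here)
import Data.List.Relation.Unary.All as All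
import Data.List.Relation.Unary.AllPairs as AllPairs
open import Data.Nat.Base using (ℕ; zero; suc; _+_; _*_; _∸_; _≤_; _<_; _/_; NonZero)
open import Data.Nat.Combinatorics using (_C_)
open import Data.Nat.ListAction using (sum)
open import Data.Nat.Properties using (_≟_; _<?_; _≤?_; ≤-irrelevant)
open import Data.Product.Base using (Σ-syntax; ∃-syntax; _×_; _,_)
open import Data.Sum.Base using (_⊎_)
open import Data.Vec.Base using (Vec; []; _∷_; _∷ʳ_; lookup; tabulate)
open import Function.Bundles using (_⇔_; mk⇔; module Equivalence)
open import Level using (0ℓ)
open import Relation.Binary.Bundles using (Setoid)
open import Relation.Binary.PropositionalEquality
  using (_≡_; refl; sym; trans; cong; subst; setoid)
open import Relation.Nullary.Decidable using (Dec; yes; no; map′; _×-dec_; _⊎-dec_; _→-dec_; ¬?)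
open import Relation.Nullary.Negation using (¬_)

------------------------------------------------------------------------
-- Patterns in permutations

-- Permutations of {1,…,n} are modelled as permutations of Fin n, so the
-- letters are 0,…,n-1 instead of 1,…,n; only their relative order is
-- ever used.
letter : ∀ {n} → Permutation′ n → Fin n → ℕ
letter π i = toℕ (π ⟨$⟩ʳ i)

OrderIsomorphic : ∀ {k} → Vec ℕ k → Vec ℕ k → Set
OrderIsomorphic u v = ∀ i j → (lookup u i < lookup u j) ⇔ (lookup v i < lookup v j)

-- i⁺ is the position directly after i.
Contains31-2 : ∀ {n} → Permutation′ n → Set
Contains31-2 {n} π =
  ∃[ i ] ∃[ i⁺ ] ∃[ j ]
    toℕ {n} i⁺ ≡ suc (toℕ {n} i) ×
    toℕ {n} i⁺ < toℕ {n} j ×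
    OrderIsomorphic (letter π i ∷ letter π i⁺ ∷ letter π j ∷ []) (3 ∷ 1 ∷ 2 ∷ [])

Avoids31-2 : ∀ {n} → Permutation′ n → Set
Avoids31-2 π = ¬ Contains31-2 π

prefix : ∀ {k n} → Permutation′ n → k ≤ n → Vec ℕ k
prefix π k≤n = tabulate (λ i → letter π (inject≤ i k≤n))

-- The first alternative is the convention that the empty permutation
-- begins with the pattern 1.
BeginsWith : ∀ {k n} → Vec ℕ k → Permutation′ n → Set
BeginsWith {k} {n} p π =
  (k ≡ 1 × n ≡ 0) ⊎
  (Σ[ k≤n ∈ k ≤ n ] OrderIsomorphic (prefix π k≤n) p)

decreasing : ∀ m → Vec ℕ m
decreasing zero    = []
decreasing (suc m) = suc m ∷ decreasing m

-- (k-1)(k-2)⋯1k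
startPattern : ∀ k → .{{NonZero k}} → Vec ℕ k
startPattern (suc m) = decreasing m ∷ʳ suc m

------------------------------------------------------------------------
-- Decidability

orderIsomorphic? : ∀ {k} (u v : Vec ℕ k) → Dec (OrderIsomorphic u v)
orderIsomorphic? u v = all? λ i → all? λ j →
  let u<? = lookup u i <? lookup u j
      v<? = lookup v i <? lookup v j
  in map′ (λ (f , g) → mk⇔ f g) (λ e → Equivalence.to e , Equivalence.from e)
          ((u<? →-dec v<?) ×-dec (v<? →-dec u<?))

contains31-2? : ∀ {n} (π : Permutation′ n) → Dec (Contains31-2 π)
contains31-2? π = any? λ i → any? λ i⁺ → any? λ j →
  (toℕ i⁺ ≟ suc (toℕ i)) ×-dec (toℕ i⁺ <? toℕ j) ×-dec
  orderIsomorphic? (letter π i ∷ letter π i⁺ ∷ letter π j ∷ []) (3 ∷ 1 ∷ 2 ∷ [])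

avoids31-2? : ∀ {n} (π : Permutation′ n) → Dec (Avoids31-2 π)
avoids31-2? π = ¬? (contains31-2? π)

beginsWith? : ∀ {k n} (p : Vec ℕ k) (π : Permutation′ n) → Dec (BeginsWith p π)
beginsWith? {k} {n} p π = ((k ≟ 1) ×-dec (n ≟ 0)) ⊎-dec prefix?
  where
  prefix? : Dec (Σ[ k≤n ∈ k ≤ n ] OrderIsomorphic (prefix π k≤n) p)
  prefix? with k ≤? n
  ... | no  k≰n = no λ (k≤n , _) → k≰n k≤n
  ... | yes k≤n = map′ (k≤n ,_)
                       (λ (k≤n′ , iso) → subst (λ le → OrderIsomorphic (prefix π le) p) (≤-irrelevant k≤n′ k≤n) iso)
                       (orderIsomorphic? (prefix π k≤n) p)

------------------------------------------------------------------------
-- Counting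

-- insert 0F j π is the permutation with first letter j whose remaining
-- letters are in the same relative order as those of π.
permutations : ∀ n → List (Permutation′ n)
permutations zero    = [ id ]
permutations (suc n) = cartesianProductWith (insert 0F) (allFin (suc n)) (permutations n)

permutationSetoid : ℕ → Setoid 0ℓ 0ℓ
permutationSetoid n = record
  { Carrier       = Permutation′ n
  ; _≈_           = _≈_
  ; isEquivalence = record
    { refl  = λ _ → refl
    ; sym   = λ e i → sym (e i)
    ; trans = λ e f i → trans (e i) (f i)
    }
  }

-- Every permutation occurs in the list exactly once (up to pointwise
-- equality, the underlying inverse functions and proofs being ignored).
permutations-complete : ∀ n → IsEnumeration (permutationSetoid n) (permutations n)
permutations-complete zero    π = here λ ()
permutations-complete (suc n) π =
  Membership.∈-resp-≈ (permutationSetoid (suc n))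
    {x = insert 0F (π ⟨$⟩ʳ 0F) (remove 0F π)} {y = π} (insert-remove 0F π)
    (Membership.∈-cartesianProductWith⁺
      (setoid (Fin (suc n))) (permutationSetoid n) (permutationSetoid (suc n))
      {insert 0F} (λ {i} {j} {ρ} {σ} → insert-cong {i} {j} {ρ} {σ})
      (∈-allFin (π ⟨$⟩ʳ 0F)) (permutations-complete n (remove 0F π)))
  where
  insert-cong : ∀ {i j} {ρ σ : Permutation′ n} → i ≡ j → ρ ≈ σ → insert 0F i ρ ≈ insert 0F j σ
  insert-cong e    f zero    = e
  insert-cong refl f (suc k) = cong (punchIn _) (f k)

permutations-unique : ∀ n → Unique.Unique (permutationSetoid n) (permutations n)
permutations-unique zero    = All.[] AllPairs.∷ AllPairs.[]
permutations-unique (suc n) =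
  Unique.cartesianProductWith⁺
    (setoid (Fin (suc n))) (permutationSetoid n) (permutationSetoid (suc n))
    (insert 0F) (λ {i} {j} {ρ} {σ} → insert-injective {i} {j} {ρ} {σ})
    (allFin⁺ (suc n)) (permutations-unique n)
  where
  insert-injective : ∀ {i j} {ρ σ : Permutation′ n} →
                     insert 0F i ρ ≈ insert 0F j σ → i ≡ j × ρ ≈ σ
  insert-injective e with refl ← e 0F =
    refl , λ k → punchIn-injective _ _ _ (e (suc k))

-- The number of 31-2-avoiding permutations of n letters beginning with p.
N₃₁₋₂ : ∀ {k} → Vec ℕ k → ℕ → ℕ
N₃₁₋₂ p n =
  length (filter (λ π → avoids31-2? π ×-dec beginsWith? p π) (permutations n))

------------------------------------------------------------------------
-- Formal power series

-- f represents Σₙ f(n) xⁿ. All series involved have coefficients in ℕ.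
Series : Set
Series = ℕ → ℕ

infixl 7 _⊛_
infixr 8 _^^_

_⊛_ : Series → Series → Series
(f ⊛ g) n = sum (map (λ i → f i * g (n ∸ i)) (upTo (suc n)))

𝟙 : Series
𝟙 zero    = 1
𝟙 (suc _) = 0

𝕩 : Series
𝕩 (suc zero) = 1
𝕩 _          = 0

_^^_ : Series → ℕ → Series
f ^^ zero  = 𝟙
f ^^ suc m = f ⊛ f ^^ m

G₃₁₋₂ : ∀ {k} → Vec ℕ k → Series
G₃₁₋₂ p n = N₃₁₋₂ p n

-- The division is exact.
catalan : ℕ → ℕ
catalan n = ((2 * n) C n) / suc n

Cat : Series
Cat n = catalan n

{-# OPTIONS --safe #-}

-- Removing the first letter j of a 31-2-avoider leaves an avoider, and an avoider
-- with first letter s (letters counted from 0) extends exactly by the letters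
-- j ≤ s + 1. So the number of avoiders that arise from a given one by d extensions
-- depends only on s, and it is [x^d] C(x)^(s+2) because C^(r+1) = C^r + x C^(r+2).
-- Of these extensions, those with j ≤ s create the initial pattern 12, which gives
-- x²C³. For k ≥ 3 the pattern forces j = s + 1, so each further letter multiplies
-- the generating function by x.

module Submission where

open import Defs
open import Data.Nat.Base using (ℕ; _+_; _∸_; _≤_; NonZero)
open import Data.Integer.Base using (+_; _-_)
open import Data.Product.Base using (_×_)
open import Relation.Binary.PropositionalEquality using (_≡_; _≗_)

open import Data.Integer.Base using (_⊖_)
open import Data.Bool.Base using (true; false; if_then_else_)
open import Data.Empty using (⊥-elim)
open import Data.Fin.Base using (Fin; zero; suc; toℕ; fromℕ<; inject≤; punchIn)
open import Data.Fin.Patterns using (0F; 1F; 2F)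
open import Data.Fin.Permutation using (Permutation′; _⟨$⟩ʳ_; _⟨$⟩ˡ_; inverseʳ; insert)
open import Data.Fin.Properties using (toℕ-fromℕ<; toℕ<n)
import Data.Integer.Properties as ℤ
open import Data.List.Base
  using (List; []; _∷_; _∷ʳ_; _++_; map; filter; length; applyUpTo; upTo; allFin; cartesianProductWith)
open import Data.List.Properties
  using (map-cong; map-∘; map-++; map-applyUpTo; map-tabulate; applyUpTo-∷ʳ; filter-none)
import Data.List.Relation.Unary.All as All
open import Data.Nat.Base using (zero; suc; _*_; _/_; _<_; z≤n; s≤s; s≤s⁻¹; s<s⁻¹)
open import Data.Nat.Combinatorics
  using (_C_; nCk≡nC[n∸k]; nCn≡1; nC1≡n; nCk+nC[k+1]≡[n+1]C[k+1]; k>n⇒nCk≡0)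
open import Data.Nat.DivMod using (m*n/n≡m)
open import Data.Nat.ListAction using (sum)
open import Data.Nat.ListAction.Properties using (sum-++)
open import Data.Nat.Properties
open import Algebra.Properties.CommutativeSemigroup +-commutativeSemigroup using (interchange)
open import Data.Nat.Tactic.RingSolver using (solve-∀)
open import Data.Product.Base using (Σ-syntax; _,_; proj₁; proj₂)
open import Data.Sum.Base using (_⊎_; inj₁; inj₂; [_,_]′)
open import Data.Vec.Base as Vec using (Vec; []; _∷_; lookup)
import Data.Vec.Properties as Vec
open import Function.Base using (_∘_; const)
open import Function.Bundles using (_⇔_; mk⇔; Equivalence)
open import Function.Related.Propositional using (equivalence)
open import Function.Related.TypeIsomorphisms using (Related-cong)
open import Relation.Binary.PropositionalEquality
  using (refl; sym; trans; cong; cong₂; subst; subst₂; module ≡-Reasoning)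
open import Relation.Nullary.Decidable using (Dec; yes; no; does; does-⇔; _×-dec_)
open import Relation.Nullary.Negation using (¬_; contradiction)

open Equivalence using (to; from)

private
  variable
    A B D : Set

⇔-cong : ∀ {A B A′ B′ : Set} → A ⇔ A′ → B ⇔ B′ → (A ⇔ B) ⇔ (A′ ⇔ B′)
⇔-cong = Related-cong {k = equivalence}

-- Power series

-- Peeling off the term i = 0 leaves a convolution with the tail of `f`. Product identities can then
-- be proved by induction on the coefficient, with the first factor varying.
⊛-suc : ∀ f g n → (f ⊛ g) (suc n) ≡ f 0 * g (suc n) + (f ∘ suc ⊛ g) n
⊛-suc f g n = cong (λ l → f 0 * g (suc n) + sum l) (begin
  map (λ i → f i * g (suc n ∸ i)) (applyUpTo suc (suc n))
    ≡⟨ map-applyUpTo suc _ (suc n) ⟩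
  applyUpTo (λ i → f (suc i) * g (n ∸ i)) (suc n)
    ≡⟨ map-applyUpTo (λ i → i) _ (suc n) ⟨
  map (λ i → f (suc i) * g (n ∸ i)) (upTo (suc n)) ∎)
  where open ≡-Reasoning

⊛-cong : ∀ {f f′ g g′} → f ≗ f′ → g ≗ g′ → f ⊛ g ≗ f′ ⊛ g′
⊛-cong e e′ n =
  cong sum (map-cong (λ i → cong₂ _*_ (e i) (e′ (n ∸ i))) (upTo (suc n)))

⊛-zeroˡ : ∀ g n → ((λ _ → 0) ⊛ g) n ≡ 0
⊛-zeroˡ g zero    = refl
⊛-zeroˡ g (suc n) = trans (⊛-suc (λ _ → 0) g n) (⊛-zeroˡ g n)

⊛-distribʳ : ∀ f f′ g n → ((λ i → f i + f′ i) ⊛ g) n ≡ (f ⊛ g) n + (f′ ⊛ g) n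
⊛-distribʳ f f′ g zero    = distrib (f 0) (f′ 0) (g 0)
  where
  distrib : ∀ a b c → (a + b) * c + 0 ≡ a * c + 0 + (b * c + 0)
  distrib = solve-∀
⊛-distribʳ f f′ g (suc n) = begin
  ((λ i → f i + f′ i) ⊛ g) (suc n)
    ≡⟨ ⊛-suc (λ i → f i + f′ i) g n ⟩
  (f 0 + f′ 0) * g (suc n) + ((λ i → f (suc i) + f′ (suc i)) ⊛ g) n
    ≡⟨ cong₂ _+_ (*-distribʳ-+ (g (suc n)) (f 0) (f′ 0)) (⊛-distribʳ (f ∘ suc) (f′ ∘ suc) g n) ⟩
  (f 0 * g (suc n) + f′ 0 * g (suc n)) + ((f ∘ suc ⊛ g) n + (f′ ∘ suc ⊛ g) n)
    ≡⟨ interchange (f 0 * g (suc n)) (f′ 0 * g (suc n)) _ _ ⟩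
  (f 0 * g (suc n) + (f ∘ suc ⊛ g) n) + (f′ 0 * g (suc n) + (f′ ∘ suc ⊛ g) n)
    ≡⟨ cong₂ _+_ (⊛-suc f g n) (⊛-suc f′ g n) ⟨
  (f ⊛ g) (suc n) + (f′ ⊛ g) (suc n) ∎
  where open ≡-Reasoning

⊛-identityˡ : ∀ g → 𝟙 ⊛ g ≗ g
⊛-identityˡ g zero    = trans (+-identityʳ _) (*-identityˡ (g 0))
⊛-identityˡ g (suc n) = begin
  (𝟙 ⊛ g) (suc n)                        ≡⟨ ⊛-suc 𝟙 g n ⟩
  1 * g (suc n) + ((λ _ → 0) ⊛ g) n      ≡⟨ cong₂ _+_ (*-identityˡ (g (suc n))) (⊛-zeroˡ g n) ⟩
  g (suc n) + 0                          ≡⟨ +-identityʳ _ ⟩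
  g (suc n)                              ∎
  where open ≡-Reasoning

-- The series x f(x), in a form that computes by matching on the index.
shift : Series → Series
shift f zero    = 0
shift f (suc n) = f n

shiftBy : ℕ → Series → Series
shiftBy zero    f = f
shiftBy (suc k) f = shift (shiftBy k f)

shift-cong : ∀ {f g} → f ≗ g → shift f ≗ shift g
shift-cong e zero    = refl
shift-cong e (suc n) = e n

shift-⊛ : ∀ f g → shift f ⊛ g ≗ shift (f ⊛ g)
shift-⊛ f g zero    = refl
shift-⊛ f g (suc n) = ⊛-suc (shift f) g n

𝕩-⊛ : ∀ f → 𝕩 ⊛ f ≗ shift f
𝕩-⊛ f zero    = refl
𝕩-⊛ f (suc n) = begin
  (𝕩 ⊛ f) (suc n)    ≡⟨ ⊛-suc 𝕩 f n ⟩
  (𝕩 ∘ suc ⊛ f) n    ≡⟨ ⊛-cong {g = f} 𝕩-suc (λ _ → refl) n ⟩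
  (𝟙 ⊛ f) n          ≡⟨ ⊛-identityˡ f n ⟩
  f n                ∎
  where
  open ≡-Reasoning
  𝕩-suc : 𝕩 ∘ suc ≗ 𝟙
  𝕩-suc zero    = refl
  𝕩-suc (suc _) = refl

𝕩^k-⊛ : ∀ k f → 𝕩 ^^ k ⊛ f ≗ shiftBy k f
𝕩^k-⊛ zero    f n = ⊛-identityˡ f n
𝕩^k-⊛ (suc k) f n = begin
  (𝕩 ^^ suc k ⊛ f) n         ≡⟨ ⊛-cong {g = f} (𝕩-⊛ (𝕩 ^^ k)) (λ _ → refl) n ⟩
  (shift (𝕩 ^^ k) ⊛ f) n     ≡⟨ shift-⊛ (𝕩 ^^ k) f n ⟩
  shift (𝕩 ^^ k ⊛ f) n       ≡⟨ shift-cong (𝕩^k-⊛ k f) n ⟩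
  shiftBy (suc k) f n        ∎
  where open ≡-Reasoning

shiftBy-≤ : ∀ k {n} f → k ≤ n → shiftBy k f n ≡ f (n ∸ k)
shiftBy-≤ zero    f k≤n       = refl
shiftBy-≤ (suc k) f (s≤s k≤n) = shiftBy-≤ k f k≤n

-- Ballot numbers

-- ballot r is the series C(x)^r; the recursion is C^(r+1) = C^r + x C^(r+2).
ballot : ℕ → Series
ballot r       zero    = 1
ballot zero    (suc m) = 0
ballot (suc r) (suc m) = ballot r (suc m) + ballot (suc (suc r)) m

-- This justifies reading `ballot r` as a power, since it is defined by a recursion on coefficients.
-- The induction is on the coefficient first and on `r` second, as the recursion of the left factor
-- leads to r at the same coefficient and to r + 2 at the preceding one.
ballot-⊛ : ∀ r s → ballot r ⊛ ballot s ≗ ballot (r + s)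
ballot-⊛ r       s zero    = refl
ballot-⊛ zero    s (suc n) = begin
  (ballot 0 ⊛ ballot s) (suc n)
    ≡⟨ ⊛-suc (ballot 0) (ballot s) n ⟩
  1 * ballot s (suc n) + ((λ _ → 0) ⊛ ballot s) n
    ≡⟨ cong₂ _+_ (*-identityˡ (ballot s (suc n))) (⊛-zeroˡ (ballot s) n) ⟩
  ballot s (suc n) + 0
    ≡⟨ +-identityʳ _ ⟩
  ballot s (suc n) ∎
  where open ≡-Reasoning
ballot-⊛ (suc r) s (suc n) = begin
  (ballot (suc r) ⊛ ballot s) (suc n)
    ≡⟨ ⊛-suc (ballot (suc r)) (ballot s) n ⟩
  1 * c + ((λ m → ballot r (suc m) + ballot (2 + r) m) ⊛ ballot s) n
    ≡⟨ cong (λ z → 1 * c + z) (⊛-distribʳ (ballot r ∘ suc) (ballot (2 + r)) (ballot s) n) ⟩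
  1 * c + ((ballot r ∘ suc ⊛ ballot s) n + (ballot (2 + r) ⊛ ballot s) n)
    ≡⟨ +-assoc (1 * c) _ _ ⟨
  1 * c + (ballot r ∘ suc ⊛ ballot s) n + (ballot (2 + r) ⊛ ballot s) n
    -- All powers of C have constant term 1, so the summand `1 * c` is also the one that completes
    -- the product with `ballot r`.
    ≡⟨ cong (_+ (ballot (2 + r) ⊛ ballot s) n) (⊛-suc (ballot r) (ballot s) n) ⟨
  (ballot r ⊛ ballot s) (suc n) + (ballot (2 + r) ⊛ ballot s) n
    ≡⟨ cong₂ _+_ (ballot-⊛ r s (suc n)) (ballot-⊛ (2 + r) s n) ⟩
  ballot (suc r + s) (suc n) ∎
  where
  open ≡-Reasoning
  c = ballot s (suc n)

ballot-zero : 𝟙 ≗ ballot 0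
ballot-zero zero    = refl
ballot-zero (suc _) = refl

ballot-^^ : ∀ {f} → f ≗ ballot 1 → ∀ r → f ^^ r ≗ ballot r
ballot-^^ e zero    n = ballot-zero n
ballot-^^ e (suc r) n = trans (⊛-cong e (ballot-^^ e r) n) (ballot-⊛ 1 r n)

-- A telescoping sum: by C^(t+1) = C^t + x C^(t+2), the summand at t is the increment of the
-- right-hand side from t to t + 1, and the right-hand side vanishes at t = 0.
∑-ballot : ∀ d t → sum (applyUpTo (λ j → ballot (2 + j) d) t) ≡ ballot t (suc d)
∑-ballot d zero    = refl
∑-ballot d (suc t) = begin
  sum (applyUpTo b (suc t))          ≡⟨ cong sum (applyUpTo-∷ʳ b t) ⟨
  sum (applyUpTo b t ∷ʳ b t)         ≡⟨ sum-++ (applyUpTo b t) (b t ∷ []) ⟩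
  sum (applyUpTo b t) + (b t + 0)    ≡⟨ cong₂ _+_ (∑-ballot d t) (+-identityʳ (b t)) ⟩
  ballot t (suc d) + b t             ∎
  where
  open ≡-Reasoning
  b = λ j → ballot (2 + j) d

-- Binomial coefficients and the closed form of the Catalan numbers

nC0≡1 : ∀ n → n C 0 ≡ 1
nC0≡1 n = trans (nCk≡nC[n∸k] (z≤n {n})) (nCn≡1 n)

-- Absorption, by induction with Pascal's rule. It relates the neighbouring coefficients that occur
-- in the Catalan formula.
C-absorption : ∀ n k → suc k * (suc n C suc k) ≡ suc n * (n C k)
C-absorption zero    zero    = refl
C-absorption zero    (suc k)
  rewrite k>n⇒nCk≡0 {1} {2 + k} (s≤s (s≤s z≤n)) | k>n⇒nCk≡0 {0} {1 + k} (s≤s z≤n) = *-zeroʳ k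
C-absorption (suc n) zero    = begin
  1 * ((2 + n) C 1)         ≡⟨ cong (1 *_) (nC1≡n (2 + n)) ⟩
  1 * (2 + n)               ≡⟨ *-comm 1 (2 + n) ⟩
  (2 + n) * 1               ≡⟨ cong ((2 + n) *_) (nC0≡1 (suc n)) ⟨
  (2 + n) * (suc n C 0)     ∎
  where open ≡-Reasoning
C-absorption (suc n) (suc k) = begin
  (2 + k) * ((2 + n) C (2 + k))
    ≡⟨ cong ((2 + k) *_) (nCk+nC[k+1]≡[n+1]C[k+1] (suc n) (suc k)) ⟨
  (2 + k) * (x + y)
    ≡⟨ expand k x y ⟩
  x + (suc k * x + (2 + k) * y)
    ≡⟨ cong (λ z → x + z) (cong₂ _+_ (C-absorption n k) (C-absorption n (suc k))) ⟩
  x + (suc n * (n C k) + suc n * (n C suc k))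
    ≡⟨ cong (λ z → x + z) (*-distribˡ-+ (suc n) (n C k) (n C suc k)) ⟨
  x + suc n * (n C k + n C suc k)
    ≡⟨ cong (λ z → x + suc n * z) (nCk+nC[k+1]≡[n+1]C[k+1] n k) ⟩
  (2 + n) * x ∎
  where
  open ≡-Reasoning
  x = suc n C suc k
  y = suc n C (2 + k)
  expand : ∀ k x y → (2 + k) * (x + y) ≡ x + ((1 + k) * x + (2 + k) * y)
  expand = solve-∀

-- Symmetry of the row 2m + 1, since m and m + 1 add up to 2m + 1.
C-middle : ∀ m → (1 + 2 * m) C m ≡ (1 + 2 * m) C suc m
C-middle m = trans (nCk≡nC[n∸k] (≤-trans (m≤m+n m (m + 0)) (n≤1+n _)))
                   (cong ((1 + 2 * m) C_) (trans (cong (_∸ m) (shuffle m)) (m+n∸m≡n m (suc m))))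
  where
  shuffle : ∀ m → 1 + 2 * m ≡ m + suc m
  shuffle = solve-∀

-- The reflection formula, with the subtrahend moved to the left.
ballot-reflection : ∀ r m →
  ballot r (suc m) + (r + (1 + 2 * m)) C m ≡ (r + (1 + 2 * m)) C suc m
ballot-reflection zero    m       = C-middle m
ballot-reflection (suc r) zero    = begin
  ballot r 1 + 1 + (suc r + 1) C 0
    ≡⟨ cong (λ z → ballot r 1 + 1 + z) (nC0≡1 (suc r + 1)) ⟩
  ballot r 1 + 1 + 1
    ≡⟨ cong (λ z → ballot r 1 + z + 1) (nC0≡1 (r + 1)) ⟨
  ballot r 1 + (r + 1) C 0 + 1
    ≡⟨ cong (_+ 1) (ballot-reflection r 0) ⟩
  (r + 1) C 1 + 1
    ≡⟨ +-comm _ 1 ⟩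
  1 + (r + 1) C 1
    ≡⟨ cong (_+ (r + 1) C 1) (nC0≡1 (r + 1)) ⟨
  (r + 1) C 0 + (r + 1) C 1
    ≡⟨ nCk+nC[k+1]≡[n+1]C[k+1] (r + 1) 0 ⟩
  (suc r + 1) C 1 ∎
  where open ≡-Reasoning
ballot-reflection (suc r) (suc m) = begin
  ballot r (2 + m) + ballot (2 + r) (suc m) + suc N C suc m
    ≡⟨ cong (λ z → ballot r (2 + m) + ballot (2 + r) (suc m) + z) (nCk+nC[k+1]≡[n+1]C[k+1] N m) ⟨
  ballot r (2 + m) + ballot (2 + r) (suc m) + (N C m + N C suc m)
    ≡⟨ regroup (ballot r (2 + m)) (ballot (2 + r) (suc m)) (N C m) (N C suc m) ⟩
  (ballot (2 + r) (suc m) + N C m) + (ballot r (2 + m) + N C suc m)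
    -- Raising r by 2 while lowering m by 1 keeps r + (1 + 2m) fixed, so both induction hypotheses
    -- concern the same row `N`, and Pascal's rule adds them up.
    ≡⟨ cong₂ _+_ (subst (λ z → ballot (2 + r) (suc m) + z C m ≡ z C suc m)
                        (index r m) (ballot-reflection (2 + r) m))
                 (ballot-reflection r (suc m)) ⟩
  N C suc m + N C (2 + m)
    ≡⟨ nCk+nC[k+1]≡[n+1]C[k+1] N (suc m) ⟩
  suc N C (2 + m) ∎
  where
  open ≡-Reasoning
  N = r + (1 + 2 * suc m)
  regroup : ∀ a b c d → a + b + (c + d) ≡ (b + c) + (a + d)
  regroup = solve-∀
  index : ∀ r m → 2 + r + (1 + 2 * m) ≡ r + (1 + 2 * suc m)
  index = solve-∀

-- Reflection with r = 1 gives b + y = x, and neighbouring coefficients satisfy (m + 1) x = (m + 2)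
-- y. Hence (m + 2) b = (m + 2) x - (m + 1) x = x, and the division by m + 2 returns b.
catalan≡ballot : Cat ≗ ballot 1
catalan≡ballot zero    = refl
catalan≡ballot (suc m) = begin
  ((2 * suc m) C suc m) / (2 + m)     ≡⟨ cong (λ z → (z C suc m) / (2 + m)) (index m) ⟩
  x / (2 + m)                         ≡⟨ cong (_/ (2 + m)) (+-cancelʳ-≡ (suc m * x) x (b * (2 + m)) scaled) ⟩
  b * (2 + m) / (2 + m)               ≡⟨ m*n/n≡m b (2 + m) ⟩
  b                                   ∎
  where
  open ≡-Reasoning
  b = ballot 1 (suc m)
  x = (2 + 2 * m) C suc m
  y = (2 + 2 * m) C m
  index : ∀ m → 2 * suc m ≡ 2 + 2 * m
  index = solve-∀
  y-sym : y ≡ (2 + 2 * m) C (2 + m)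
  y-sym = trans (nCk≡nC[n∸k] (≤-trans (m≤m+n m (m + 0)) (m≤n+m _ 2)))
                (cong ((2 + 2 * m) C_) (trans (cong (_∸ m) (shuffle m)) (m+n∸m≡n m (2 + m))))
    where
    shuffle : ∀ m → 2 + 2 * m ≡ m + (2 + m)
    shuffle = solve-∀
  -- Absorption turns both sides into 2m + 2 times a middle coefficient of the row 2m + 1; for the
  -- right-hand side, y is first reflected.
  balance : suc m * x ≡ (2 + m) * y
  balance = begin
    suc m * x                                 ≡⟨ C-absorption (1 + 2 * m) m ⟩
    (2 + 2 * m) * ((1 + 2 * m) C m)           ≡⟨ cong ((2 + 2 * m) *_) (C-middle m) ⟩
    (2 + 2 * m) * ((1 + 2 * m) C suc m)       ≡⟨ C-absorption (1 + 2 * m) (suc m) ⟨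
    (2 + m) * ((2 + 2 * m) C (2 + m))         ≡⟨ cong ((2 + m) *_) y-sym ⟨
    (2 + m) * y                               ∎
  scaled : x + suc m * x ≡ b * (2 + m) + suc m * x
  scaled = begin
    (2 + m) * x                       ≡⟨ cong ((2 + m) *_) (ballot-reflection 1 m) ⟨
    (2 + m) * (b + y)                 ≡⟨ *-distribˡ-+ (2 + m) b y ⟩
    (2 + m) * b + (2 + m) * y         ≡⟨ cong₂ _+_ (*-comm (2 + m) b) (sym balance) ⟩
    b * (2 + m) + suc m * x           ∎

-- Counting by sums

∑ : (A → ℕ) → List A → ℕ
∑ f xs = sum (map f xs)

∑-cong : ∀ {f g : A → ℕ} → f ≗ g → ∑ f ≗ ∑ g
∑-cong e xs = cong sum (map-cong e xs)

∑-zero : ∀ (xs : List A) → ∑ (λ _ → 0) xs ≡ 0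
∑-zero []       = refl
∑-zero (x ∷ xs) = ∑-zero xs

∑-+ : ∀ (f g : A → ℕ) xs → ∑ (λ x → f x + g x) xs ≡ ∑ f xs + ∑ g xs
∑-+ f g []       = refl
∑-+ f g (x ∷ xs) = trans (cong (λ z → f x + g x + z) (∑-+ f g xs)) (interchange (f x) (g x) _ _)

∑-* : ∀ c (f : A → ℕ) xs → ∑ (λ x → c * f x) xs ≡ c * ∑ f xs
∑-* c f []       = sym (*-zeroʳ c)
∑-* c f (x ∷ xs) = trans (cong (λ z → c * f x + z) (∑-* c f xs)) (sym (*-distribˡ-+ c (f x) _))

-- The second list becomes the outer range of summation. For `permutations`, this groups together
-- all extensions of one shorter permutation.
∑-cartesianProductWith : ∀ (g : D → ℕ) (f : A → B → D) xs ys →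
  ∑ g (cartesianProductWith f xs ys) ≡ ∑ (λ y → ∑ (λ x → g (f x y)) xs) ys
∑-cartesianProductWith g f []       ys = sym (∑-zero ys)
∑-cartesianProductWith g f (x ∷ xs) ys = begin
  sum (map g (map (f x) ys ++ cartesianProductWith f xs ys))
    ≡⟨ cong sum (map-++ g (map (f x) ys) _) ⟩
  sum (map g (map (f x) ys) ++ map g (cartesianProductWith f xs ys))
    ≡⟨ sum-++ (map g (map (f x) ys)) _ ⟩
  ∑ g (map (f x) ys) + ∑ g (cartesianProductWith f xs ys)
    ≡⟨ cong₂ _+_ (cong sum (sym (map-∘ ys))) (∑-cartesianProductWith g f xs ys) ⟩
  ∑ (λ y → g (f x y)) ys + ∑ (λ y → ∑ (λ x → g (f x y)) xs) ys
    ≡⟨ ∑-+ (λ y → g (f x y)) _ ys ⟨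
  ∑ (λ y → ∑ (λ x → g (f x y)) (x ∷ xs)) ys ∎
  where open ≡-Reasoning

♯ : Dec A → ℕ
♯ d = if does d then 1 else 0

♯-⇔ : A ⇔ B → (a? : Dec A) (b? : Dec B) → ♯ a? ≡ ♯ b?
♯-⇔ e a? b? = cong (λ b → if b then 1 else 0) (does-⇔ e a? b?)

♯-× : (a? : Dec A) (b? : Dec B) → ♯ (a? ×-dec b?) ≡ ♯ a? * ♯ b?
♯-× (yes _) b? = sym (+-identityʳ (♯ b?))
♯-× (no _)  b? = refl

length-filter : ∀ {P : A → Set} (P? : ∀ x → Dec (P x)) xs →
                length (filter P? xs) ≡ ∑ (λ x → ♯ (P? x)) xs
length-filter P? []       = refl
length-filter P? (x ∷ xs) with does (P? x)
... | true  = cong suc (length-filter P? xs)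
... | false = length-filter P? xs

∑-allFin-suc : ∀ n (f : Fin (suc n) → ℕ) →
               ∑ f (allFin (suc n)) ≡ f zero + ∑ (f ∘ suc) (allFin n)
∑-allFin-suc n f =
  cong (λ l → f zero + sum l) (trans (map-tabulate suc f) (sym (map-tabulate (λ i → i) (f ∘ suc))))

∑-below : ∀ n {t} (f : ℕ → ℕ) → t ≤ n →
          ∑ (λ j → ♯ (toℕ j <? t) * f (toℕ j)) (allFin n) ≡ sum (applyUpTo f t)
∑-below n       f z≤n       = ∑-zero (allFin n)
∑-below (suc n) {suc t} f (s≤s t≤n) = trans (∑-allFin-suc n (λ j → ♯ (toℕ j <? suc t) * f (toℕ j)))
  (cong₂ _+_ (*-identityˡ (f 0)) (∑-below n (f ∘ suc) t≤n))

∑-point : ∀ n {t} → t < n → ∑ (λ j → ♯ (toℕ j ≟ t)) (allFin n) ≡ 1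
∑-point (suc n) {zero}  t<n       = trans (∑-allFin-suc n (λ j → ♯ (toℕ j ≟ 0))) (cong suc (∑-zero (allFin n)))
∑-point (suc n) {suc t} (s≤s t<n) = trans (∑-allFin-suc n (λ j → ♯ (toℕ j ≟ suc t))) (∑-point n t<n)

-- Prepending a letter

-- The action of `punchIn` on values: letters from x upwards move up by one, so x becomes free.
-- Without the `Fin` indices it applies to patterns as well as to permutations.
raise : ℕ → ℕ → ℕ
raise zero    a       = suc a
raise (suc x) zero    = zero
raise (suc x) (suc a) = suc (raise x a)

toℕ-punchIn : ∀ {n} (j : Fin (suc n)) i → toℕ (punchIn j i) ≡ raise (toℕ j) (toℕ i)
toℕ-punchIn zero    i       = refl
toℕ-punchIn (suc j) zero    = refl
toℕ-punchIn (suc j) (suc i) = cong suc (toℕ-punchIn j i)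

raise-< : ∀ x a b → raise x a < raise x b ⇔ a < b
raise-< zero    a       b       = mk⇔ s<s⁻¹ s≤s
raise-< (suc x) zero    zero    = mk⇔ (λ ()) (λ ())
raise-< (suc x) zero    (suc b) = mk⇔ (λ _ → s≤s z≤n) (λ _ → s≤s z≤n)
raise-< (suc x) (suc a) zero    = mk⇔ (λ ()) (λ ())
raise-< (suc x) (suc a) (suc b) =
  mk⇔ (s≤s ∘ to (raise-< x a b) ∘ s<s⁻¹) (s≤s ∘ from (raise-< x a b) ∘ s<s⁻¹)

raise-below : ∀ x a → raise x a < x ⇔ a < x
raise-below zero    a       = mk⇔ (λ ()) (λ ())
raise-below (suc x) zero    = mk⇔ (λ _ → s≤s z≤n) (λ _ → s≤s z≤n)
raise-below (suc x) (suc a) =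
  mk⇔ (s≤s ∘ to (raise-below x a) ∘ s<s⁻¹) (s≤s ∘ from (raise-below x a) ∘ s<s⁻¹)

-- No raised letter equals x, hence the weak inequality before raising.
raise-above : ∀ x a → x < raise x a ⇔ x ≤ a
raise-above zero    a       = mk⇔ (λ _ → z≤n) (λ _ → s≤s z≤n)
raise-above (suc x) zero    = mk⇔ (λ ()) (λ ())
raise-above (suc x) (suc a) =
  mk⇔ (s≤s ∘ to (raise-above x a) ∘ s<s⁻¹) (s≤s ∘ from (raise-above x a) ∘ s≤s⁻¹)

raise-fixed : ∀ {x a} → a < x → raise x a ≡ a
raise-fixed {suc x} {zero}  _         = refl
raise-fixed {suc x} {suc a} (s≤s a<x) = cong suc (raise-fixed a<x)

raise-self : ∀ x → raise x x ≡ suc x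
raise-self zero    = refl
raise-self (suc x) = cong suc (raise-self x)

letter-insert : ∀ {n} (j : Fin (suc n)) (σ : Permutation′ n) i →
                letter (insert 0F j σ) (suc i) ≡ raise (toℕ j) (letter σ i)
letter-insert j σ i = toℕ-punchIn j (σ ⟨$⟩ʳ i)

-- The chain b < c < a settles all nine comparisons.
orderIsomorphic-312 : ∀ a b c →
  OrderIsomorphic (a ∷ b ∷ c ∷ []) (3 ∷ 1 ∷ 2 ∷ []) ⇔ (b < c × c < a)
orderIsomorphic-312 a b c = mk⇔ forward backward
  where
  1<2 : 1 < 2
  1<2 = s≤s (s≤s z≤n)
  2<3 : 2 < 3
  2<3 = s≤s 1<2
  1<3 : 1 < 3
  1<3 = s≤s (s≤s z≤n)
  both : ∀ {x y u v} → x < y → u < v → (x < y) ⇔ (u < v)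
  both p q = mk⇔ (const q) (const p)
  neither : ∀ {x y u v} → y ≤ x → v ≤ u → (x < y) ⇔ (u < v)
  neither p q = mk⇔ (λ r → contradiction r (≤⇒≯ p)) (λ r → contradiction r (≤⇒≯ q))
  forward : OrderIsomorphic (a ∷ b ∷ c ∷ []) (3 ∷ 1 ∷ 2 ∷ []) → b < c × c < a
  forward iso = from (iso 1F 2F) 1<2 , from (iso 2F 0F) 2<3
  backward : b < c × c < a → OrderIsomorphic (a ∷ b ∷ c ∷ []) (3 ∷ 1 ∷ 2 ∷ [])
  backward (b<c , c<a) 0F 0F = neither ≤-refl ≤-refl
  backward (b<c , c<a) 0F 1F = neither (<⇒≤ (<-trans b<c c<a)) (<⇒≤ 1<3)
  backward (b<c , c<a) 0F 2F = neither (<⇒≤ c<a) (<⇒≤ 2<3)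
  backward (b<c , c<a) 1F 0F = both (<-trans b<c c<a) 1<3
  backward (b<c , c<a) 1F 1F = neither ≤-refl ≤-refl
  backward (b<c , c<a) 1F 2F = both b<c 1<2
  backward (b<c , c<a) 2F 0F = both c<a 2<3
  backward (b<c , c<a) 2F 1F = neither (<⇒≤ b<c) (<⇒≤ 1<2)
  backward (b<c , c<a) 2F 2F = neither ≤-refl ≤-refl

-- Occurrences of 31-2 and the new first letter

module _ {n} (j : Fin (2 + n)) (σ : Permutation′ (suc n)) where

  private
    x s : ℕ
    x = toℕ j
    s = letter σ 0F
    π = insert 0F j σ

  contains-insert-tail : Contains31-2 σ → Contains31-2 π
  contains-insert-tail (i , i⁺ , l , i⁺≡ , i⁺<l , iso) =
    suc i , suc i⁺ , suc l , cong suc i⁺≡ , s≤s i⁺<l ,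
    from (orderIsomorphic-312 _ _ _)
      ( subst₂ _<_ (sym (letter-insert j σ i⁺)) (sym (letter-insert j σ l))
          (from (raise-< x _ _) (proj₁ 312-like))
      , subst₂ _<_ (sym (letter-insert j σ l)) (sym (letter-insert j σ i))
          (from (raise-< x _ _) (proj₂ 312-like)))
    where 312-like = to (orderIsomorphic-312 _ _ _) iso

  -- The letter with value s + 1 in σ lies strictly between s and the new first letter.
  contains-insert-head : 2 + s ≤ x → Contains31-2 π
  contains-insert-head 2+s≤x =
    0F , 1F , suc l , refl , s≤s 0<l ,
    from (orderIsomorphic-312 _ _ _)
      ( subst₂ _<_ (sym (letter-insert j σ 0F)) (sym (letter-insert j σ l))
          (from (raise-< x _ _) (≤-reflexive (sym σl)))
      , subst (_< x) (sym (letter-insert j σ l))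
          (from (raise-below x _) (subst (_< x) (sym σl) 2+s≤x)))
    where
    v<n : suc s < suc n
    v<n = s<s⁻¹ (<-≤-trans (s≤s 2+s≤x) (toℕ<n j))
    l : Fin (suc n)
    l = σ ⟨$⟩ˡ fromℕ< v<n
    σl : letter σ l ≡ suc s
    σl = trans (cong toℕ (inverseʳ σ)) (toℕ-fromℕ< v<n)
    -- The first position of σ carries s and not s + 1. So in π the letter at `l` comes after the
    -- adjacent pair at the front.
    0<l : 0 < toℕ l
    0<l with l | σl
    ... | zero  | s≡1+s = contradiction (sym s≡1+s) 1+n≢n
    ... | suc _ | _     = s≤s z≤n

  -- An occurrence away from the new position already lies in σ. Otherwise the new letter plays the
  -- 3, adjacency makes s the 1, and a letter strictly between them forces x to be at least s + 2.
  contains-insert⁻ : Contains31-2 π → Contains31-2 σ ⊎ 2 + s ≤ x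
  contains-insert⁻ (zero , suc zero , suc l , _ , _ , iso) = inj₂
    (≤-trans (s≤s (to (raise-< x _ _)
                (subst₂ _<_ (letter-insert j σ 0F) (letter-insert j σ l) (proj₁ 312-like))))
             (to (raise-below x _) (subst (_< x) (letter-insert j σ l) (proj₂ 312-like))))
    where 312-like = to (orderIsomorphic-312 _ _ _) iso
  contains-insert⁻ (suc i , suc i⁺ , suc l , i⁺≡ , i⁺<l , iso) = inj₁
    ( i , i⁺ , l , suc-injective i⁺≡ , s<s⁻¹ i⁺<l
    , from (orderIsomorphic-312 _ _ _)
        ( to (raise-< x _ _)
            (subst₂ _<_ (letter-insert j σ i⁺) (letter-insert j σ l) (proj₁ 312-like))
        , to (raise-< x _ _)
            (subst₂ _<_ (letter-insert j σ l) (letter-insert j σ i) (proj₂ 312-like))))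
    where 312-like = to (orderIsomorphic-312 _ _ _) iso

  avoids-insert : Avoids31-2 π ⇔ (Avoids31-2 σ × x < 2 + s)
  avoids-insert = mk⇔
    (λ av → av ∘ contains-insert-tail , ≰⇒> (av ∘ contains-insert-head))
    (λ (av , x<2+s) → [ av , <⇒≱ x<2+s ]′ ∘ contains-insert⁻)

-- Initial patterns after prepending a letter

orderIsomorphic-raise : ∀ {k} x y (u v : Vec ℕ k) →
  OrderIsomorphic (x ∷ Vec.map (raise x) u) (y ∷ Vec.map (raise y) v) ⇔
  (OrderIsomorphic u v × (∀ i → lookup u i < x ⇔ lookup v i < y))
orderIsomorphic-raise x y u v = mk⇔
  (λ iso → (λ i j → to (⇔-cong (inner x u i j) (inner y v i j)) (iso (suc i) (suc j)))
         , (λ i → to (⇔-cong (below x u i) (below y v i)) (iso (suc i) zero)))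
  backward
  where
  inner : ∀ {k} x (u : Vec ℕ k) i j →
    lookup (Vec.map (raise x) u) i < lookup (Vec.map (raise x) u) j ⇔ lookup u i < lookup u j
  inner x u i j rewrite Vec.lookup-map i (raise x) u | Vec.lookup-map j (raise x) u = raise-< x _ _
  below : ∀ {k} x (u : Vec ℕ k) i → lookup (Vec.map (raise x) u) i < x ⇔ lookup u i < x
  below x u i rewrite Vec.lookup-map i (raise x) u = raise-below x _
  above : ∀ {k} x (u : Vec ℕ k) i → x < lookup (Vec.map (raise x) u) i ⇔ x ≤ lookup u i
  above x u i rewrite Vec.lookup-map i (raise x) u = raise-above x _
  backward : OrderIsomorphic u v × (∀ i → lookup u i < x ⇔ lookup v i < y) →
             OrderIsomorphic (x ∷ Vec.map (raise x) u) (y ∷ Vec.map (raise y) v)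
  backward (iso , b) zero    zero    = mk⇔ (⊥-elim ∘ <-irrefl refl) (⊥-elim ∘ <-irrefl refl)
  -- As no raised letter equals the head, being above the head is the negation of being below it,
  -- which `b` controls.
  backward (iso , b) zero    (suc j) = from (⇔-cong (above x u j) (above y v j))
    (mk⇔ (λ le → ≮⇒≥ (≤⇒≯ le ∘ from (b j))) (λ le → ≮⇒≥ (≤⇒≯ le ∘ to (b j))))
  backward (iso , b) (suc i) zero    = from (⇔-cong (below x u i) (below y v i)) (b i)
  backward (iso , b) (suc i) (suc j) = from (⇔-cong (inner x u i j) (inner y v i j)) (iso i j)

prefix-insert : ∀ {k n} (j : Fin (suc n)) (σ : Permutation′ n) (k≤n : k ≤ n) →
  prefix (insert 0F j σ) (s≤s k≤n) ≡ toℕ j ∷ Vec.map (raise (toℕ j)) (prefix σ k≤n)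
prefix-insert j σ k≤n = cong (toℕ j ∷_)
  (trans (Vec.tabulate-cong (λ i → letter-insert j σ (inject≤ i k≤n)))
         (Vec.tabulate-∘ (raise (toℕ j)) _))

-- The letters m, ..., 1 lie below m + 1 and stay fixed, while the final m + 1 is raised to m + 2.
-- So the pattern grows by the same operation as a permutation under `insert`.
startPattern-suc : ∀ m → startPattern (2 + m) ≡ suc m ∷ Vec.map (raise (suc m)) (startPattern (suc m))
startPattern-suc m = cong (suc m ∷_) (sym (trans (Vec.map-∷ʳ (raise (suc m)) (suc m) (decreasing m))
  (cong₂ Vec._∷ʳ_ (fixed ≤-refl) (raise-self (suc m)))))
  where
  fixed : ∀ {l} → l ≤ m → Vec.map (raise (suc m)) (decreasing l) ≡ decreasing l
  fixed {zero}  _   = refl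
  fixed {suc l} l<m = cong₂ _∷_ (raise-fixed (s≤s l<m)) (fixed (<⇒≤ l<m))

begins-insert : ∀ m {n} (j : Fin (suc n)) (σ : Permutation′ n) →
  BeginsWith (startPattern (2 + m)) (insert 0F j σ) ⇔
  (Σ[ k≤n ∈ suc m ≤ n ]
    OrderIsomorphic (prefix σ k≤n) (startPattern (suc m)) ×
    (∀ i → lookup (prefix σ k≤n) i < toℕ j ⇔ lookup (startPattern (suc m)) i < suc m))
begins-insert m j σ = mk⇔
  (λ { (inj₁ (() , _))
     ; (inj₂ (s≤s k≤n , iso)) → k≤n , to (orderIsomorphic-raise _ _ _ _)
         (subst₂ OrderIsomorphic (prefix-insert j σ k≤n) (startPattern-suc m) iso) })
  (λ (k≤n , iso) → inj₂ (s≤s k≤n ,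
     subst₂ OrderIsomorphic (sym (prefix-insert j σ k≤n)) (sym (startPattern-suc m))
       (from (orderIsomorphic-raise _ _ _ _) iso)))

<-irrefl-⇔ : ∀ {a b} → (a < a) ⇔ (b < b)
<-irrefl-⇔ = mk⇔ (⊥-elim ∘ <-irrefl refl) (⊥-elim ∘ <-irrefl refl)

begins-1 : ∀ {n} (π : Permutation′ n) → BeginsWith (startPattern 1) π
begins-1 {zero}  π = inj₁ (refl , refl)
begins-1 {suc n} π = inj₂ (s≤s z≤n , λ { zero zero → <-irrefl-⇔ })

-- The new word starts with an ascent exactly when s is raised above j, that is, when j ≤ s; this is
-- stricter than the bound j ≤ s + 1 from avoidance.
begins-12-insert : ∀ {n} (j : Fin (2 + n)) (σ : Permutation′ (suc n)) →
  (Avoids31-2 (insert 0F j σ) × BeginsWith (startPattern 2) (insert 0F j σ)) ⇔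
  (Avoids31-2 σ × toℕ j < suc (letter σ 0F))
begins-12-insert j σ = mk⇔
  (λ (av , bw) → proj₁ (to (avoids-insert j σ) av) ,
     s≤s (≮⇒≥ (<-irrefl refl ∘ to (proj₂ (proj₂ (to (begins-insert 0 j σ) bw)) zero))))
  (λ (av , x≤s) → from (avoids-insert j σ) (av , m≤n⇒m≤1+n x≤s) ,
     from (begins-insert 0 j σ)
       (s≤s z≤n , (λ { zero zero → <-irrefl-⇔ }) ,
        λ { zero → mk⇔ (⊥-elim ∘ ≤⇒≯ (s≤s⁻¹ x≤s)) (⊥-elim ∘ <-irrefl refl) }))

-- With first letters u₀ and v₀ the pattern asks for j > u₀, avoidance for
-- j ≤ u₀ + 1; and j = u₀ + 1 compares with the u's as v₀ + 1 does with the v's.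
begins-insert-suc : ∀ m {n} (j : Fin (2 + n)) (σ : Permutation′ (suc n)) →
  (Avoids31-2 (insert 0F j σ) × BeginsWith (startPattern (3 + m)) (insert 0F j σ)) ⇔
  ((Avoids31-2 σ × BeginsWith (startPattern (2 + m)) σ) × toℕ j ≡ suc (letter σ 0F))
begins-insert-suc m {n} j σ = mk⇔ forward backward
  where
  forward : Avoids31-2 (insert 0F j σ) × BeginsWith (startPattern (3 + m)) (insert 0F j σ) →
            (Avoids31-2 σ × BeginsWith (startPattern (2 + m)) σ) × toℕ j ≡ suc (letter σ 0F)
  forward (av , bw) with to (avoids-insert j σ) av | to (begins-insert (suc m) j σ) bw
  ... | av′ , x<2+s | k≤n , iso , b =
    (av′ , inj₂ (k≤n , iso)) , ≤-antisym (s≤s⁻¹ x<2+s) (from (b zero) ≤-refl)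
  backward : (Avoids31-2 σ × BeginsWith (startPattern (2 + m)) σ) × toℕ j ≡ suc (letter σ 0F) →
             Avoids31-2 (insert 0F j σ) × BeginsWith (startPattern (3 + m)) (insert 0F j σ)
  backward ((av , inj₁ (() , _)) , _)
  backward ((av , inj₂ (k≤n , iso)) , x≡1+s) =
    from (avoids-insert j σ) (av , s≤s (≤-reflexive x≡1+s)) ,
    from (begins-insert (suc m) j σ) (k≤n , iso , λ i →
      subst (λ x → lookup (prefix σ k≤n) i < x ⇔ _) (sym x≡1+s)
        (mk⇔ (λ lt → s≤s (≮⇒≥ (≤⇒≯ (s≤s⁻¹ lt) ∘ from (iso zero i))))
             (λ lt → s≤s (≮⇒≥ (≤⇒≯ (s≤s⁻¹ lt) ∘ to (iso zero i))))))

-- Counting avoiders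

N-∑ : ∀ {k} (p : Vec ℕ k) n →
  N₃₁₋₂ p n ≡ ∑ (λ π → ♯ (avoids31-2? π ×-dec beginsWith? p π)) (permutations n)
N-∑ p n = length-filter _ (permutations n)

∑-permutations : ∀ n (g : Permutation′ (suc n) → ℕ) →
  ∑ g (permutations (suc n)) ≡ ∑ (λ σ → ∑ (λ j → g (insert 0F j σ)) (allFin (suc n))) (permutations n)
∑-permutations n g = ∑-cartesianProductWith g (insert 0F) (allFin (suc n)) (permutations n)

-- The avoiders have length n + 1, so that a first letter exists.
weight : ∀ n → (ℕ → ℕ) → ℕ
weight n f = ∑ (λ π → ♯ (avoids31-2? π) * f (letter π 0F)) (permutations (suc n))

weight-cong : ∀ n {f g} → f ≗ g → weight n f ≡ weight n g
weight-cong n e = ∑-cong (λ π → cong (♯ (avoids31-2? π) *_) (e (letter π 0F))) (permutations (suc n))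

weight-+ : ∀ n f g → weight n (λ s → f s + g s) ≡ weight n f + weight n g
weight-+ n f g = trans
  (∑-cong (λ π → *-distribˡ-+ (♯ (avoids31-2? π)) (f (letter π 0F)) (g (letter π 0F))) (permutations (suc n)))
  (∑-+ (λ π → ♯ (avoids31-2? π) * f (letter π 0F))
       (λ π → ♯ (avoids31-2? π) * g (letter π 0F)) (permutations (suc n)))

∑-avoids-insert : ∀ {n} f (σ : Permutation′ (suc n)) →
  ∑ (λ j → ♯ (avoids31-2? (insert 0F j σ)) * f (toℕ j)) (allFin (2 + n)) ≡
  ♯ (avoids31-2? σ) * sum (applyUpTo f (2 + letter σ 0F))
∑-avoids-insert {n} f σ = begin
  ∑ (λ j → ♯ (avoids31-2? (insert 0F j σ)) * f (toℕ j)) (allFin (2 + n))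
    ≡⟨ ∑-cong split (allFin (2 + n)) ⟩
  ∑ (λ j → ♯ (avoids31-2? σ) * (♯ (toℕ j <? t) * f (toℕ j))) (allFin (2 + n))
    ≡⟨ ∑-* (♯ (avoids31-2? σ)) (λ j → ♯ (toℕ j <? t) * f (toℕ j)) (allFin (2 + n)) ⟩
  ♯ (avoids31-2? σ) * ∑ (λ j → ♯ (toℕ j <? t) * f (toℕ j)) (allFin (2 + n))
    -- Since s ≤ n, the bound s + 2 does not exceed the number n + 2 of letters.
    ≡⟨ cong (♯ (avoids31-2? σ) *_) (∑-below (2 + n) f (s≤s (toℕ<n (σ ⟨$⟩ʳ 0F)))) ⟩
  ♯ (avoids31-2? σ) * sum (applyUpTo f t) ∎
  where
  open ≡-Reasoning
  t = 2 + letter σ 0F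
  split : ∀ j → ♯ (avoids31-2? (insert 0F j σ)) * f (toℕ j) ≡
                ♯ (avoids31-2? σ) * (♯ (toℕ j <? t) * f (toℕ j))
  split j = begin
    ♯ (avoids31-2? (insert 0F j σ)) * f (toℕ j)
      ≡⟨ cong (_* f (toℕ j)) (♯-⇔ (avoids-insert j σ)
           (avoids31-2? (insert 0F j σ)) (avoids31-2? σ ×-dec (toℕ j <? t))) ⟩
    ♯ (avoids31-2? σ ×-dec (toℕ j <? t)) * f (toℕ j)
      ≡⟨ cong (_* f (toℕ j)) (♯-× (avoids31-2? σ) (toℕ j <? t)) ⟩
    ♯ (avoids31-2? σ) * ♯ (toℕ j <? t) * f (toℕ j)
      ≡⟨ *-assoc (♯ (avoids31-2? σ)) (♯ (toℕ j <? t)) (f (toℕ j)) ⟩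
    ♯ (avoids31-2? σ) * (♯ (toℕ j <? t) * f (toℕ j)) ∎

-- Removing the first letter trades length for a new weight: f is summed over the letters 0 to s + 1
-- that may be prepended.
weight-suc : ∀ n f → weight (suc n) f ≡ weight n (λ s → sum (applyUpTo f (2 + s)))
weight-suc n f = trans
  (∑-permutations (suc n) (λ π → ♯ (avoids31-2? π) * f (letter π 0F)))
  (∑-cong (∑-avoids-insert f) (permutations (suc n)))

weight-zero : ∀ f → weight 0 f ≡ f 0
weight-zero f = trans (+-identityʳ _) (*-identityˡ (f 0))

-- Each removal of a first letter lowers n and raises d by one, as `∑-ballot` sums the weights to
-- the next coefficient of the same power. At length 1 the only letter is 0, which leaves C^2.
weight-ballot : ∀ n d → weight n (λ s → ballot (2 + s) d) ≡ ballot 2 (n + d)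
weight-ballot zero    d = weight-zero (λ s → ballot (2 + s) d)
weight-ballot (suc n) d = begin
  weight (suc n) (λ s → ballot (2 + s) d)
    ≡⟨ weight-suc n (λ s → ballot (2 + s) d) ⟩
  weight n (λ s → sum (applyUpTo (λ j → ballot (2 + j) d) (2 + s)))
    ≡⟨ weight-cong n (λ s → ∑-ballot d (2 + s)) ⟩
  weight n (λ s → ballot (2 + s) (suc d))
    ≡⟨ weight-ballot n (suc d) ⟩
  ballot 2 (n + suc d)
    ≡⟨ cong (ballot 2) (+-suc n d) ⟩
  ballot 2 (suc n + d) ∎
  where open ≡-Reasoning

-- Avoiders with a prescribed beginning

N-1 : G₃₁₋₂ (startPattern 1) ≗ ballot 1
N-1 zero    = refl
N-1 (suc n) = begin
  N₃₁₋₂ (startPattern 1) (suc n)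
    ≡⟨ N-∑ (startPattern 1) (suc n) ⟩
  ∑ (λ π → ♯ (avoids31-2? π ×-dec beginsWith? (startPattern 1) π)) (permutations (suc n))
    ≡⟨ ∑-cong drop (permutations (suc n)) ⟩
  weight n (λ s → ballot (2 + s) 0)
    ≡⟨ weight-ballot n 0 ⟩
  ballot 2 (n + 0)
    -- By C = 1 + x C^2, `ballot 1 (suc n)` unfolds to `ballot 2 n`.
    ≡⟨ cong (ballot 2) (+-identityʳ n) ⟩
  ballot 1 (suc n) ∎
  where
  open ≡-Reasoning
  drop : ∀ (π : Permutation′ (suc n)) → ♯ (avoids31-2? π ×-dec beginsWith? (startPattern 1) π) ≡ ♯ (avoids31-2? π) * 1
  drop π = begin
    ♯ (avoids31-2? π ×-dec beginsWith? (startPattern 1) π)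
      ≡⟨ ♯-⇔ (mk⇔ proj₁ (_, begins-1 π))
             (avoids31-2? π ×-dec beginsWith? (startPattern 1) π) (avoids31-2? π) ⟩
    ♯ (avoids31-2? π)
      ≡⟨ *-identityʳ (♯ (avoids31-2? π)) ⟨
    ♯ (avoids31-2? π) * 1 ∎

N-<length : ∀ m {n} → n < 2 + m → N₃₁₋₂ (startPattern (2 + m)) n ≡ 0
N-<length m {n} n<k = cong length (filter-none
  (λ π → avoids31-2? π ×-dec beginsWith? (startPattern (2 + m)) π)
  (All.universal {P = λ π → ¬ (Avoids31-2 π × BeginsWith (startPattern (2 + m)) π)}
    (λ { π (_ , inj₁ (() , _)) ; π (_ , inj₂ (k≤n , _)) → <⇒≱ n<k k≤n })
    (permutations n)))

-- An avoider of length n + 1 has s + 1 extensions with an initial ascent and one more, j = s + 1,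
-- without. Adding the `ballot 2 n` extensions of the latter kind therefore gives all avoiders of
-- length n + 2, counted by `ballot 2 (n + 1)`, and cancellation leaves `ballot 3 n`.
N-12 : ∀ n → N₃₁₋₂ (startPattern 2) (2 + n) ≡ ballot 3 n
N-12 n = +-cancelʳ-≡ (ballot 2 n) _ _ (begin
  N₃₁₋₂ (startPattern 2) (2 + n) + ballot 2 n
    ≡⟨ cong₂ _+_ ascents (trans (cong (ballot 2) (sym (+-identityʳ n))) (sym (weight-ballot n 0))) ⟩
  weight n (λ s → ballot (1 + s) 1) + weight n (λ s → 1)
    ≡⟨ weight-+ n (λ s → ballot (1 + s) 1) (λ s → 1) ⟨
  weight n (λ s → ballot (2 + s) 1)
    ≡⟨ weight-ballot n 1 ⟩
  ballot 2 (n + 1)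
    ≡⟨ cong (ballot 2) (+-comm n 1) ⟩
  ballot 2 n + ballot 3 n
    ≡⟨ +-comm (ballot 2 n) _ ⟩
  ballot 3 n + ballot 2 n ∎)
  where
  open ≡-Reasoning
  p = startPattern 2
  module _ (σ : Permutation′ (suc n)) where
    t = 1 + letter σ 0F
    split : ∀ j → ♯ (avoids31-2? (insert 0F j σ) ×-dec beginsWith? p (insert 0F j σ)) ≡
                  ♯ (avoids31-2? σ) * (♯ (toℕ j <? t) * 1)
    split j = begin
      ♯ (avoids31-2? (insert 0F j σ) ×-dec beginsWith? p (insert 0F j σ))
        ≡⟨ ♯-⇔ (begins-12-insert j σ) (avoids31-2? (insert 0F j σ) ×-dec beginsWith? p (insert 0F j σ))
               (avoids31-2? σ ×-dec (toℕ j <? t)) ⟩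
      ♯ (avoids31-2? σ ×-dec (toℕ j <? t))
        ≡⟨ ♯-× (avoids31-2? σ) (toℕ j <? t) ⟩
      ♯ (avoids31-2? σ) * ♯ (toℕ j <? t)
        ≡⟨ cong (♯ (avoids31-2? σ) *_) (*-identityʳ (♯ (toℕ j <? t))) ⟨
      ♯ (avoids31-2? σ) * (♯ (toℕ j <? t) * 1) ∎
    count : ∑ (λ j → ♯ (avoids31-2? (insert 0F j σ) ×-dec beginsWith? p (insert 0F j σ))) (allFin (2 + n)) ≡
            ♯ (avoids31-2? σ) * ballot t 1
    count = begin
      ∑ (λ j → ♯ (avoids31-2? (insert 0F j σ) ×-dec beginsWith? p (insert 0F j σ))) (allFin (2 + n))
        ≡⟨ ∑-cong split (allFin (2 + n)) ⟩
      ∑ (λ j → ♯ (avoids31-2? σ) * (♯ (toℕ j <? t) * 1)) (allFin (2 + n))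
        ≡⟨ ∑-* (♯ (avoids31-2? σ)) (λ j → ♯ (toℕ j <? t) * 1) (allFin (2 + n)) ⟩
      ♯ (avoids31-2? σ) * ∑ (λ j → ♯ (toℕ j <? t) * 1) (allFin (2 + n))
        ≡⟨ cong (♯ (avoids31-2? σ) *_)
             (∑-below (2 + n) (λ _ → 1) (m≤n⇒m≤1+n (toℕ<n (σ ⟨$⟩ʳ 0F)))) ⟩
      ♯ (avoids31-2? σ) * sum (applyUpTo (λ _ → 1) t)
        -- Each summand 1 is the constant term of a power of C, so the number t appears as
        -- `ballot t 1`.
        ≡⟨ cong (♯ (avoids31-2? σ) *_) (∑-ballot 0 t) ⟩
      ♯ (avoids31-2? σ) * ballot t 1 ∎
  ascents : N₃₁₋₂ p (2 + n) ≡ weight n (λ s → ballot (1 + s) 1)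
  ascents = trans (N-∑ p (2 + n))
    (trans (∑-permutations (suc n) (λ π → ♯ (avoids31-2? π ×-dec beginsWith? p π)))
           (∑-cong count (permutations (suc n))))

N-suc : ∀ m n → N₃₁₋₂ (startPattern (3 + m)) (2 + n) ≡ N₃₁₋₂ (startPattern (2 + m)) (1 + n)
N-suc m n = begin
  N₃₁₋₂ p (2 + n)
    ≡⟨ N-∑ p (2 + n) ⟩
  ∑ (λ π → ♯ (avoids31-2? π ×-dec beginsWith? p π)) (permutations (2 + n))
    ≡⟨ ∑-permutations (suc n) (λ π → ♯ (avoids31-2? π ×-dec beginsWith? p π)) ⟩
  ∑ (λ σ → ∑ (λ j → ♯ (avoids31-2? (insert 0F j σ) ×-dec beginsWith? p (insert 0F j σ))) (allFin (2 + n)))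
    (permutations (suc n))
    ≡⟨ ∑-cong count (permutations (suc n)) ⟩
  ∑ (λ σ → ♯ (good? σ)) (permutations (suc n))
    ≡⟨ N-∑ q (suc n) ⟨
  N₃₁₋₂ q (suc n) ∎
  where
  open ≡-Reasoning
  p = startPattern (3 + m)
  q = startPattern (2 + m)
  good? : ∀ (σ : Permutation′ (suc n)) → Dec (Avoids31-2 σ × BeginsWith q σ)
  good? σ = avoids31-2? σ ×-dec beginsWith? q σ
  module _ (σ : Permutation′ (suc n)) where
    t = suc (letter σ 0F)
    split : ∀ j → ♯ (avoids31-2? (insert 0F j σ) ×-dec beginsWith? p (insert 0F j σ)) ≡
                  ♯ (good? σ) * ♯ (toℕ j ≟ t)
    split j = begin
      ♯ (avoids31-2? (insert 0F j σ) ×-dec beginsWith? p (insert 0F j σ))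
        ≡⟨ ♯-⇔ (begins-insert-suc m j σ) (avoids31-2? (insert 0F j σ) ×-dec beginsWith? p (insert 0F j σ))
               (good? σ ×-dec (toℕ j ≟ t)) ⟩
      ♯ (good? σ ×-dec (toℕ j ≟ t))
        ≡⟨ ♯-× (good? σ) (toℕ j ≟ t) ⟩
      ♯ (good? σ) * ♯ (toℕ j ≟ t) ∎
    count : ∑ (λ j → ♯ (avoids31-2? (insert 0F j σ) ×-dec beginsWith? p (insert 0F j σ))) (allFin (2 + n)) ≡
            ♯ (good? σ)
    count = begin
      ∑ (λ j → ♯ (avoids31-2? (insert 0F j σ) ×-dec beginsWith? p (insert 0F j σ))) (allFin (2 + n))
        ≡⟨ ∑-cong split (allFin (2 + n)) ⟩
      ∑ (λ j → ♯ (good? σ) * ♯ (toℕ j ≟ t)) (allFin (2 + n))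
        ≡⟨ ∑-* (♯ (good? σ)) (λ j → ♯ (toℕ j ≟ t)) (allFin (2 + n)) ⟩
      ♯ (good? σ) * ∑ (λ j → ♯ (toℕ j ≟ t)) (allFin (2 + n))
        -- The forced letter s + 1 is at most n + 1, so exactly one j attains it.
        ≡⟨ cong (♯ (good? σ) *_) (∑-point (2 + n) (s≤s (toℕ<n (σ ⟨$⟩ʳ 0F)))) ⟩
      ♯ (good? σ) * 1
        ≡⟨ *-identityʳ (♯ (good? σ)) ⟩
      ♯ (good? σ) ∎

N-startPattern : ∀ m → G₃₁₋₂ (startPattern (2 + m)) ≗ shiftBy (2 + m) (ballot 3)
N-startPattern zero    zero          = N-<length 0 (s≤s z≤n)
N-startPattern zero    (suc zero)    = N-<length 0 (s≤s (s≤s z≤n))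
N-startPattern zero    (suc (suc n)) = N-12 n
-- `N-suc` starts at length 2; the lengths 0 and 1 are too short for the pattern.
N-startPattern (suc m) zero          = N-<length (suc m) (s≤s z≤n)
N-startPattern (suc m) (suc zero)    = N-<length (suc m) (s≤s (s≤s z≤n))
N-startPattern (suc m) (suc (suc n)) = trans (N-suc m n) (N-startPattern m (suc n))

-- Once the Catalan numbers are written as `ballot 1`, they unfold to `ballot 2 d + ballot 3 d` and
-- `ballot 2 d`: this is x^2 C^3 = (C - 1) - x C in coefficients.
ballot-3-difference : ∀ d → + ballot 3 d ≡ + catalan (d + 2) - + catalan (d + 1)
ballot-3-difference d
  rewrite +-comm d 2 | +-comm d 1 | catalan≡ballot (2 + d) | catalan≡ballot (1 + d) = begin
  + ballot 3 d                        ≡⟨ cong +_ (m+n∸m≡n (ballot 2 d) (ballot 3 d)) ⟨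
  + (ballot 2 d + ballot 3 d ∸ ballot 2 d)
                                      ≡⟨ ℤ.⊖-≥ (m≤m+n (ballot 2 d) (ballot 3 d)) ⟨
  (ballot 2 d + ballot 3 d) ⊖ ballot 2 d
                                      ≡⟨ ℤ.m-n≡m⊖n (ballot 2 d + ballot 3 d) (ballot 2 d) ⟨
  + (ballot 2 d + ballot 3 d) - + ballot 2 d ∎
  where open ≡-Reasoning

proposition20 : ∀ (k : ℕ) → .{{_ : NonZero k}} →
    ( (2 ≤ k → G₃₁₋₂ (startPattern k) ≗ 𝕩 ^^ k ⊛ Cat ^^ 3)
    × (k ≡ 1 → G₃₁₋₂ (startPattern k) ≗ Cat))
    ×
    (∀ (n : ℕ) → k ≤ n →
    (2 ≤ k → + N₃₁₋₂ (startPattern k) n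
    ≡ + catalan (n ∸ k + 2) - + catalan (n ∸ k + 1))
    × (k ≡ 1 → + N₃₁₋₂ (startPattern k) n ≡ + catalan n))
proposition20 1 =
  ( (λ { (s≤s ()) })
  , λ _ n → trans (N-1 n) (sym (catalan≡ballot n)))
  , λ n _ → (λ { (s≤s ()) }) , λ _ → cong +_ (trans (N-1 n) (sym (catalan≡ballot n)))
proposition20 k@(suc (suc m)) =
  ( (λ _ n → trans (N-startPattern m n)
      (sym (trans (⊛-cong {f = 𝕩 ^^ k} (λ _ → refl) (ballot-^^ catalan≡ballot 3) n)
                  (𝕩^k-⊛ k (ballot 3) n))))
  , λ ())
  , λ n k≤n → (λ _ → trans (cong +_ (trans (N-startPattern m n) (shiftBy-≤ k (ballot 3) k≤n)))
                           (ballot-3-difference (n ∸ k)))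
            , λ ()
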